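{- Let $\mathcal{H}=\{rrb,rby\}$. Then, as $n\to\infty$, $h_2(n,\mathcal{H})=\Theta(\sqrt{n})$.
   Context: Edge-colorings of the complete graph $K_n$ use colors from $\{r,b,y\}$ (red, blue, yellow); they need not be proper, and not all colors need be used. A pattern is an edge-colored triangle, denoted by the multiset of the colors of its three edges; e.g. $rrb$ is the triangle with two red edges and one blue edge, and $rby$ is the rainbow triangle with one edge of each color. For a family $\mathcal{H}$ of patterns, $\operatorname{Forb}(n,\mathcal{H})$ is the set of all edge-colorings of $K_n$ with colors from $\{r,b,y\}$ in which no triangle has a coloring belonging to $\mathcal{H}$. For an edge-coloring $c$ of $K_n$, $h_2(c)$ is the maximum $k$ such that there is a set of $k$ vertices whose induced edges use at most two of the three colors. Finally, $h_2(n,\mathcal{H})=\min\{h_2(c): c\in\operatorname{Forb}(n,\mathcal{H})\}$. -}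

module Defs where

open import Data.Fin.Base using (Fin; zero; suc; finToFun; funToFin)
import Data.Fin.Properties as Fin
open import Data.Fin.Properties using (any?; all?; finToFun-funToFin)
open import Data.Fin.Subset using (Subset; _∈_; ∣_∣; ⊥)
open import Data.Fin.Subset.Properties using (_∈?_; anySubset?; ∣p∣≤n; ∣⊥∣≡0; ∉⊥)
open import Data.Integer.Base using (+_)
open import Data.List.Base using (List; []; _∷_)
open import Data.List.Membership.DecPropositional using () renaming (_∈?_ to mem?)
open import Data.List.Membership.Propositional using () renaming (_∈_ to _∈ˡ_)
open import Data.List.Membership.Propositional.Properties using (∈-∃++)
open import Data.List.Relation.Binary.Permutation.Propositional
  using (_↭_; ↭-refl; ↭-sym; ↭-trans; prep)
open import Data.List.Relation.Binary.Permutation.Propositional.Properties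
  using (∈-resp-↭; ↭-empty-inv; drop-∷; shift)
open import Data.List.Relation.Unary.All as All using (All; []; _∷_)
open import Data.List.Relation.Unary.Any using (here; there)
open import Data.Nat.Base using (ℕ; zero; suc; _≤_; _+_; _^_; z≤n)
import Data.Nat.Properties as ℕ
open import Data.Product.Base using (Σ; Σ-syntax; ∃; ∃-syntax; ∃₂; _×_; _,_; proj₁; proj₂)
open import Data.Rational.Base as ℚ using (ℚ; 0ℚ)
open import Data.Sum.Base using (_⊎_; inj₁; inj₂)
open import Data.Vec.Base using (Vec; []; _∷_; toList)
open import Relation.Binary.PropositionalEquality
open import Relation.Nullary using (Dec; yes; no; ¬_; ¬?; contradiction)
open import Relation.Nullary.Decidable using (map′; _×-dec_; _⊎-dec_; _→-dec_)
open import Relation.Unary using (Decidable)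

IsMaximum : (ℕ → Set) → ℕ → Set
IsMaximum P k = P k × (∀ m → P m → m ≤ k)

IsMinimum : (ℕ → Set) → ℕ → Set
IsMinimum P k = P k × (∀ m → P m → k ≤ m)

maximum : ∀ {P : ℕ → Set} → Decidable P → ∃ P →
          ∀ n → (∀ m → P m → m ≤ n) → ∃ (IsMaximum P)
maximum P? ne n ub with P? n
... | yes pn = n , pn , ub
maximum {P} P? (m , pm) zero ub | no ¬pn =
  contradiction (subst P (ℕ.n≤0⇒n≡0 (ub m pm)) pm) ¬pn
maximum {P} P? ne (suc n) ub | no ¬pn = maximum P? ne n λ m pm →
  ℕ.≤-pred (ℕ.≤∧≢⇒< (ub m pm) λ m≡n → ¬pn (subst P m≡n pm))

minimum : ∀ {P : ℕ → Set} → Decidable P → ∃ P → ∃ (IsMinimum P)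
minimum {P} P? (n , pn) = search n zero (ℕ.+-identityʳ n) λ _ _ → z≤n
  where
  search : ∀ d k → d + k ≡ n → (∀ m → P m → k ≤ m) → ∃ (IsMinimum P)
  search d k eq lb with P? k
  ... | yes pk = k , pk , lb
  search zero    k eq lb | no ¬pk = contradiction (subst P (sym eq) pn) ¬pk
  search (suc d) k eq lb | no ¬pk =
    search d (suc k) (trans (ℕ.+-suc d k) eq) λ m pm →
      ℕ.≤∧≢⇒< (lb m pm) λ k≡m → ¬pk (subst P (sym k≡m) pm)

data Color : Set where
  red blue yellow : Color

-- The values `color i i` carry no meaning: Avoids and AtMostTwoColors only
-- look at pairs of distinct vertices.
record Coloring (n : ℕ) : Set where
  constructor mkColoring
  field
    color     : Fin n → Fin n → Color
    symmetric : ∀ i j → color i j ≡ color j i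

open Coloring public

-- A multiset of three colors; vectors are compared up to permutation.
Pattern : Set
Pattern = Vec Color 3

HasPattern : ∀ {n} → Coloring n → (i j k : Fin n) → Pattern → Set
HasPattern c i j k p =
  (color c i j ∷ color c j k ∷ color c i k ∷ []) ↭ toList p

Avoids : ∀ {n} → List Pattern → Coloring n → Set
Avoids {n} H c = ∀ (i j k : Fin n) → i ≢ j → j ≢ k → i ≢ k →
                 All (λ p → ¬ HasPattern c i j k p) H

Forb : ℕ → List Pattern → Set
Forb n H = Σ[ c ∈ Coloring n ] Avoids H c

AtMostTwoColors : ∀ {n} → Coloring n → Subset n → Set
AtMostTwoColors c S = ∃₂ λ x y → ∀ i j → i ∈ S → j ∈ S → i ≢ j →
                      color c i j ≡ x ⊎ color c i j ≡ y

HasTwoColoredSet : ∀ {n} → Coloring n → ℕ → Set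
HasTwoColoredSet {n} c k =
  Σ[ S ∈ Subset n ] ∣ S ∣ ≡ k × AtMostTwoColors c S

private
  toFin : Color → Fin 3
  toFin red    = zero
  toFin blue   = suc zero
  toFin yellow = suc (suc zero)

  fromFin : Fin 3 → Color
  fromFin zero             = red
  fromFin (suc zero)       = blue
  fromFin (suc (suc zero)) = yellow

  fromFin-toFin : ∀ x → fromFin (toFin x) ≡ x
  fromFin-toFin red    = refl
  fromFin-toFin blue   = refl
  fromFin-toFin yellow = refl

infix 4 _≟_ _↭?_ _≗ᶜ_

_≟_ : (x y : Color) → Dec (x ≡ y)
x ≟ y = map′ (λ eq → trans (sym (fromFin-toFin x)) (trans (cong fromFin eq) (fromFin-toFin y)))
             (cong toFin) (toFin x Fin.≟ toFin y)

_↭?_ : (xs ys : List Color) → Dec (xs ↭ ys)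
[] ↭? []      = yes ↭-refl
[] ↭? (y ∷ ys) = no λ p → contradiction (↭-empty-inv (↭-sym p)) λ ()
(x ∷ xs) ↭? ys with mem? _≟_ x ys
... | no x∉ys = no λ p → x∉ys (∈-resp-↭ p (here refl))
... | yes x∈ys with as , bs , refl ← ∈-∃++ x∈ys =
  map′ (λ p → ↭-trans (prep x p) (↭-sym (shift x as bs)))
       (λ q → drop-∷ (↭-trans q (shift x as bs)))
       (xs ↭? _)

avoids? : ∀ {n} H → Decidable (Avoids {n} H)
avoids? H c =
  all? λ i → all? λ j → all? λ k →
  ¬? (i Fin.≟ j) →-dec (¬? (j Fin.≟ k) →-dec (¬? (i Fin.≟ k) →-dec
  All.all? (λ p → ¬? (_ ↭? toList p)) H))

private
  anyColor? : ∀ {P : Color → Set} → Decidable P → Dec (∃ P)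
  anyColor? {P} P? =
    map′ (λ (k , p) → fromFin k , p)
         (λ (x , p) → toFin x , subst P (sym (fromFin-toFin x)) p)
         (any? λ k → P? (fromFin k))

atMostTwoColors? : ∀ {n} (c : Coloring n) → Decidable (AtMostTwoColors c)
atMostTwoColors? c S =
  anyColor? λ x → anyColor? λ y →
  all? λ i → all? λ j →
  (i ∈? S) →-dec ((j ∈? S) →-dec (¬? (i Fin.≟ j) →-dec
  ((color c i j ≟ x) ⊎-dec (color c i j ≟ y))))

hasTwoColoredSet? : ∀ {n} (c : Coloring n) → Decidable (HasTwoColoredSet c)
hasTwoColoredSet? c k = anySubset? λ S → (∣ S ∣ ℕ.≟ k) ×-dec atMostTwoColors? c S

_≗ᶜ_ : ∀ {n} → Coloring n → Coloring n → Set
c ≗ᶜ d = ∀ i j → color c i j ≡ color d i j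

Avoids-resp : ∀ {n H} (c d : Coloring n) → c ≗ᶜ d → Avoids H c → Avoids H d
Avoids-resp c d c≗d av i j k i≢j j≢k i≢k
  rewrite sym (c≗d i j) | sym (c≗d j k) | sym (c≗d i k) = av i j k i≢j j≢k i≢k

HasTwoColoredSet-resp : ∀ {n k} (c d : Coloring n) → c ≗ᶜ d →
                        HasTwoColoredSet c k → HasTwoColoredSet d k
HasTwoColoredSet-resp c d c≗d (S , eq , x , y , two) =
  S , eq , x , y , λ i j i∈S j∈S i≢j →
    subst (λ z → z ≡ x ⊎ z ≡ y) (c≗d i j) (two i j i∈S j∈S i≢j)

anyColoring? : ∀ {n} {P : Coloring n → Set} → Decidable P →
               (∀ {c d} → c ≗ᶜ d → P c → P d) → Dec (∃ P)
anyColoring? {n} {P} P? resp =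
  map′ (λ (k , s , p) → mkColoring (matrix k) s , p) complete (any? dec)
  where
  matrix : Fin ((3 ^ n) ^ n) → Fin n → Fin n → Color
  matrix k i j = fromFin (finToFun (finToFun {3 ^ n} {n} k i) j)

  Symmetric : Fin ((3 ^ n) ^ n) → Set
  Symmetric k = ∀ i j → matrix k i j ≡ matrix k j i

  Q : Fin ((3 ^ n) ^ n) → Set
  Q k = Σ[ s ∈ Symmetric k ] P (mkColoring (matrix k) s)

  dec : Decidable Q
  dec k with all? (λ i → all? (λ j → matrix k i j ≟ matrix k j i))
  ... | no ¬s = no λ (s , _) → ¬s s
  ... | yes s = map′ (s ,_) (λ (_ , p) → resp (λ _ _ → refl) p) (P? _)

  encode : Coloring n → Fin ((3 ^ n) ^ n)
  encode c = funToFin {n} λ i → funToFin λ j → toFin (color c i j)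

  decode : ∀ c i j → matrix (encode c) i j ≡ color c i j
  decode c i j
    rewrite finToFun-funToFin {n} (λ i → funToFin λ j → toFin (color c i j)) i
          | finToFun-funToFin (λ j → toFin (color c i j)) j
    = fromFin-toFin _

  complete : ∃ P → ∃ Q
  complete (c , p) =
    encode c ,
    (λ i j → trans (decode c i j) (trans (symmetric c i j) (sym (decode c j i)))) ,
    resp (λ i j → sym (decode c i j)) p

abstract
  h₂-maximum : ∀ {n} (c : Coloring n) → ∃ (IsMaximum (HasTwoColoredSet c))
  h₂-maximum {n} c = maximum (hasTwoColoredSet? c)
    (0 , ⊥ , ∣⊥∣≡0 n , red , red , λ i j i∈⊥ → contradiction i∈⊥ ∉⊥)
    n λ { _ (S , refl , _) → ∣p∣≤n S }

h₂ : ∀ {n} → Coloring n → ℕ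
h₂ c = proj₁ (h₂-maximum c)

h₂-spec : ∀ {n} (c : Coloring n) → IsMaximum (HasTwoColoredSet c) (h₂ c)
h₂-spec c = proj₂ (h₂-maximum c)

h₂-resp : ∀ {n} (c d : Coloring n) → c ≗ᶜ d → h₂ c ≡ h₂ d
h₂-resp c d c≗d = ℕ.≤-antisym
  (proj₂ (h₂-spec d) _ (HasTwoColoredSet-resp c d c≗d (proj₁ (h₂-spec c))))
  (proj₂ (h₂-spec c) _ (HasTwoColoredSet-resp d c (λ i j → sym (c≗d i j)) (proj₁ (h₂-spec d))))

IsH₂Value : ℕ → List Pattern → ℕ → Set
IsH₂Value n H k = Σ[ f ∈ Forb n H ] h₂ (proj₁ f) ≡ k

abstract
  minH₂-minimum : ∀ n H → Forb n H → ∃ (IsMinimum (IsH₂Value n H))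
  minH₂-minimum n H f = minimum value? (h₂ (proj₁ f) , f , refl)
    where
    value? : Decidable (IsH₂Value n H)
    value? k = map′ (λ (c , av , eq) → (c , av) , eq) (λ ((c , av) , eq) → c , av , eq)
      (anyColoring? (λ c → avoids? H c ×-dec (h₂ c ℕ.≟ k))
        λ {c} {d} c≗d (av , eq) → Avoids-resp c d c≗d av , trans (sym (h₂-resp c d c≗d)) eq)

-- For a general family H the set Forb n H may be empty and then has no
-- minimum, so an element is required; by minH₂-spec the value of minH₂
-- does not depend on it.
minH₂ : ∀ n H → Forb n H → ℕ
minH₂ n H f = proj₁ (minH₂-minimum n H f)

minH₂-spec : ∀ n H (f : Forb n H) → IsMinimum (IsH₂Value n H) (minH₂ n H f)
minH₂-spec n H f = proj₂ (minH₂-minimum n H f)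

ℋ : List Pattern
ℋ = (red ∷ red ∷ blue ∷ []) ∷ (red ∷ blue ∷ yellow ∷ []) ∷ []

allBlue : ∀ n → Forb n ℋ
allBlue n = mkColoring (λ _ _ → blue) (λ _ _ → refl) , λ _ _ _ _ _ _ →
  no-red (here refl) ∷ no-red (here refl) ∷ []
  where
  no-red : ∀ {p} → red ∈ˡ p → ¬ ((blue ∷ blue ∷ blue ∷ []) ↭ p)
  no-red red∈p q with ∈-resp-↭ (↭-sym q) red∈p
  ... | there (there (there ()))

fromℕ : ℕ → ℚ
fromℕ n = + n ℚ./ 1

-- f(n) = Θ(√n): c·√n ≤ f(n) ≤ C·√n for all large n, with c, C > 0.  All terms
-- are nonnegative, so the inequalities are squared to avoid the irrational √n;
-- rational constants suffice, since a real c may be decreased and C increased.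
IsΘ√ : (ℕ → ℕ) → Set
IsΘ√ f =
  ∃[ c ] ∃[ C ] 0ℚ ℚ.< c × 0ℚ ℚ.< C × ∃[ n₀ ] ∀ n → n₀ ≤ n →
    (c ℚ.* c) ℚ.* fromℕ n ℚ.≤ fromℕ (f n) ℚ.* fromℕ (f n) ×
    fromℕ (f n) ℚ.* fromℕ (f n) ℚ.≤ (C ℚ.* C) ℚ.* fromℕ n

module Submission where

open import Defs

-- Lower bound: take a maximal set I with no red edge inside. The closed red
-- neighbourhoods of its vertices cover everything, and none contains a blue
-- edge because rrb is forbidden; so n ≤ ∣I∣ h₂ ≤ h₂².
--
-- Upper bound: let G be a graph on N vertices with no clique of size 10 and
-- no independent set larger than O(√N). Color N × N by substituting a
-- yellow/red copy of G for every vertex of a yellow/blue copy of G. A set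
-- without yellow has independent projection and fibres, hence size O(N); a
-- set without red has fibres of size < 10, and a set without blue has a
-- projection of size < 10, hence both have size O(N). The graph G is a random
-- graph with edge probability 1/q on N = q⁴ vertices, derandomized by
-- conditional expectations.

open import Data.Bool.Base using (Bool; true; false; if_then_else_)
open import Data.Fin.Base using (Fin; zero; suc; combine; inject≤; remQuot)
import Data.Fin.Properties as Fin
open import Data.Fin.Properties using (any?)
open import Data.Fin.Subset
  using (Subset; inside; outside; _∈_; _∉_; _⊆_; ∣_∣; ⊥; ⊤; ⁅_⁆; _─_)
open import Data.Fin.Subset.Properties
  using (_∈?_; nonempty?; p⊆q⇒∣p∣≤∣q∣; p─q⊆p; s⊆s; x∈⁅x⁆; ∉⊥; ∣p∣≤n; ∣⁅x⁆∣≡1; ∣⊤∣≡n; ∣⊥∣≡0; ⊥⊆)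
import Data.Integer.Base as ℤ
import Data.Integer.Properties as ℤ
open import Data.List.Base using (List; []; _∷_; _++_; length; map)
open import Data.List.Membership.Propositional using () renaming (_∈_ to _∈ˡ_)
open import Data.List.Membership.Propositional.Properties using (∈-map⁺; ∈-++⁺ˡ; ∈-++⁺ʳ)
open import Data.List.Properties using (length-++; length-map; map-++)
open import Data.List.Relation.Binary.Permutation.Propositional
  using (_↭_; prep; swap; ↭-refl; ↭-sym; ↭-trans)
open import Data.List.Relation.Binary.Permutation.Propositional.Properties using (∈-resp-↭; shift)
open import Data.List.Relation.Unary.All as All using (All; []; _∷_)
import Data.List.Relation.Unary.All.Properties as All
open import Data.List.Relation.Unary.Any using (here; there)
open import Data.Maybe.Base using (Maybe; just; nothing)
import Data.Maybe.Relation.Unary.All as Maybe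
open import Data.Nat.Base
open import Data.Nat.ListAction using (sum)
open import Data.Nat.ListAction.Properties using (sum-++)
open import Data.Nat.Properties hiding (_≟_)
open import Data.Nat.Tactic.RingSolver using (solve-∀)
open import Data.Product.Base using (∃-syntax; _×_; _,_; proj₁; proj₂; uncurry)
open import Data.Rational.Base as ℚ using (toℚᵘ)
import Data.Rational.Properties as ℚ
open import Data.Rational.Unnormalised.Base as ℚᵘ using (ℚᵘ; mkℚᵘ; *≡*; *≤*)
import Data.Rational.Unnormalised.Properties as ℚᵘ
open import Data.Sum.Base using (_⊎_; inj₁; inj₂)
open import Data.Vec.Base as Vec using (Vec; []; _∷_; drop; here; lookup; tabulate; take; there; toList)
open import Data.Vec.Properties using (lookup∘tabulate; lookup⇒[]=; take++drop≡id; []=⇒lookup)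
open import Data.Vec.Relation.Binary.Pointwise.Inductive as Pointwise using (Pointwise; []; _∷_)
open import Function.Base using (_∘_)
open import Level using (0ℓ)
open import Relation.Binary.Core using (Rel)
import Relation.Binary.Definitions as Binary
open import Relation.Binary.PropositionalEquality hiding ([_])
open import Relation.Nullary using (Dec; yes; no; does; ¬_; ¬?; contradiction)
open import Relation.Nullary.Decidable using (dec-false; dec-true; from-yes; _×-dec_; _⊎-dec_)
open import Relation.Unary using (Decidable; Pred)

-- Ramsey graphs by conditional expectations

-- A Boolean vector in which each entry is true with probability 1 / suc p;
-- `weight r` is (suc p) ^ m times the probability of agreeing with r.
Event : ℕ → Set
Event = Vec (Maybe Bool)

Agrees : ∀ {m} → Vec Bool m → Event m → Set
Agrees = Pointwise (λ b → Maybe.All (b ≡_))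

module Weights (p : ℕ) where

  bit : Bool → ℕ
  bit true  = 1
  bit false = p

  weight : ∀ {m} → Event m → ℕ
  weight []             = 1
  weight (nothing ∷ r)  = suc p * weight r
  weight (just b ∷ r)   = bit b * weight r

  totalWeight : ∀ {m} → List (Event m) → ℕ
  totalWeight = sum ∘ map weight

  restrict : ∀ {m} → Bool → List (Event (suc m)) → List (Event m)
  restrict b     []                      = []
  restrict b     ((nothing ∷ r) ∷ rs)    = r ∷ restrict b rs
  restrict true  ((just true ∷ r) ∷ rs)  = r ∷ restrict true rs
  restrict true  ((just false ∷ r) ∷ rs) = restrict true rs
  restrict false ((just true ∷ r) ∷ rs)  = restrict false rs
  restrict false ((just false ∷ r) ∷ rs) = r ∷ restrict false rs

  -- Condition on the first entry, where `true` has weight 1 and `false` weight `p`. An event that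
  -- leaves this entry free puts its tail into both restricted lists, which accounts for the factor
  -- `suc p = 1 + p`.
  totalWeight-restrict : ∀ {m} (rs : List (Event (suc m))) →
    totalWeight rs ≡ totalWeight (restrict true rs) + p * totalWeight (restrict false rs)
  totalWeight-restrict [] = sym (*-zeroʳ p)
  totalWeight-restrict ((nothing ∷ r) ∷ rs) rewrite totalWeight-restrict rs =
    rearrange p (weight r) (totalWeight (restrict true rs)) (totalWeight (restrict false rs))
    where
    rearrange : ∀ p w x y → suc p * w + (x + p * y) ≡ (w + x) + p * (w + y)
    rearrange = solve-∀
  totalWeight-restrict ((just true ∷ r) ∷ rs) rewrite totalWeight-restrict rs =
    rearrange p (weight r) (totalWeight (restrict true rs)) (totalWeight (restrict false rs))
    where
    rearrange : ∀ p w x y → 1 * w + (x + p * y) ≡ (w + x) + p * y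
    rearrange = solve-∀
  totalWeight-restrict ((just false ∷ r) ∷ rs) rewrite totalWeight-restrict rs =
    rearrange p (weight r) (totalWeight (restrict true rs)) (totalWeight (restrict false rs))
    where
    rearrange : ∀ p w x y → p * w + (x + p * y) ≡ x + p * (w + y)
    rearrange = solve-∀

  avoid-restrict : ∀ {m} b {v : Vec Bool m} rs →
    All (λ r → ¬ Agrees v r) (restrict b rs) → All (λ r → ¬ Agrees (b ∷ v) r) rs
  avoid-restrict b [] _ = []
  avoid-restrict b ((nothing ∷ r) ∷ rs) (a ∷ as) =
    (λ { (_ ∷ q) → a q }) ∷ avoid-restrict b rs as
  avoid-restrict true ((just true ∷ r) ∷ rs) (a ∷ as) =
    (λ { (_ ∷ q) → a q }) ∷ avoid-restrict true rs as
  avoid-restrict true ((just false ∷ r) ∷ rs) as =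
    (λ { (Maybe.just () ∷ _) }) ∷ avoid-restrict true rs as
  avoid-restrict false ((just true ∷ r) ∷ rs) as =
    (λ { (Maybe.just () ∷ _) }) ∷ avoid-restrict false rs as
  avoid-restrict false ((just false ∷ r) ∷ rs) (a ∷ as) =
    (λ { (_ ∷ q) → a q }) ∷ avoid-restrict false rs as

  average-< : ∀ x y {z} → x + p * y < suc p * z → x < z ⊎ y < z
  average-< x y {z} lt with x <? z | y <? z
  ... | yes x<z | _       = inj₁ x<z
  ... | no _    | yes y<z = inj₂ y<z
  ... | no x≮z  | no y≮z  =
    contradiction lt (≤⇒≯ (+-mono-≤ (≮⇒≥ x≮z) (*-monoʳ-≤ p (≮⇒≥ y≮z))))

  -- Method of conditional expectations: one of the two values of the first
  -- entry keeps the expected number of occurring events below one.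
  avoid : ∀ {m} (rs : List (Event m)) → totalWeight rs < suc p ^ m →
          ∃[ v ] All (λ r → ¬ Agrees v r) rs
  avoid {zero} []        _  = [] , []
  avoid {zero} ([] ∷ rs) (s≤s ())
  avoid {suc m} rs lt
    with average-< (totalWeight (restrict true rs)) _
           (subst (_< suc p ^ suc m) (totalWeight-restrict rs) lt)
  ... | inj₁ lt′ with v , av ← avoid (restrict true rs) lt′ = true ∷ v , avoid-restrict true rs av
  ... | inj₂ lt′ with v , av ← avoid (restrict false rs) lt′ = false ∷ v , avoid-restrict false rs av

  weight-++ : ∀ {m n} (r : Event m) (s : Event n) → weight (r Vec.++ s) ≡ weight r * weight s
  weight-++ [] s = sym (+-identityʳ _)
  weight-++ (nothing ∷ r) s rewrite weight-++ r s = sym (*-assoc (suc p) (weight r) (weight s))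
  weight-++ (just b ∷ r) s rewrite weight-++ r s = sym (*-assoc (bit b) (weight r) (weight s))

-- Random graphs and the weights of homogeneous sets

pairs : ℕ → ℕ
pairs zero    = 0
pairs (suc n) = n + pairs n

-- `pairs n` is the binomial coefficient n choose 2. Its recursion fixes the layout: in a graph on
-- `suc n` vertices the first `n` bits are the row of vertex zero, and the rest is the graph on the
-- other vertices.
Graph : ℕ → Set
Graph n = Vec Bool (pairs n)

-- The diagonal entries carry no meaning.
adjacent : ∀ {n} → Graph n → Fin n → Fin n → Bool
adjacent {suc n} g zero    zero    = false
adjacent {suc n} g zero    (suc j) = lookup (take n g) j
adjacent {suc n} g (suc i) zero    = lookup (take n g) i
adjacent {suc n} g (suc i) (suc j) = adjacent (drop n g) i j

adjacent-sym : ∀ {n} (g : Graph n) i j → adjacent {n} g i j ≡ adjacent {n} g j i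
adjacent-sym {suc n} g zero    zero    = refl
adjacent-sym {suc n} g zero    (suc j) = refl
adjacent-sym {suc n} g (suc i) zero    = refl
adjacent-sym {suc n} g (suc i) (suc j) = adjacent-sym {n} (drop n g) i j

Homogeneous : ∀ {n} → Graph n → Bool → Subset n → Set
Homogeneous {n} g b S = ∀ i j → i ∈ S → j ∈ S → i ≢ j → adjacent {n} g i j ≡ b

star : ∀ {n} → Bool → Subset n → Event n
star b = Vec.map (λ s → if s then just b else nothing)

-- A vertex outside the set contributes a row of free entries, written `star b ⊥` so that one lemma
-- on stars serves both cases.
homogeneous : ∀ {n} → Bool → Subset n → Event (pairs n)
homogeneous b []            = []
homogeneous b (outside ∷ S) = star b ⊥ Vec.++ homogeneous b S
homogeneous b (inside ∷ S)  = star b S Vec.++ homogeneous b S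

agrees-star : ∀ {n b} (v : Vec Bool n) S → (∀ i → i ∈ S → lookup v i ≡ b) → Agrees v (star b S)
agrees-star []      []            eq = []
agrees-star (x ∷ v) (inside ∷ S)  eq =
  Maybe.just (eq zero here) ∷ agrees-star v S (λ i → eq (suc i) ∘ there)
agrees-star (x ∷ v) (outside ∷ S) eq =
  Maybe.nothing ∷ agrees-star v S (λ i → eq (suc i) ∘ there)

agrees-split : ∀ {m n} (v : Vec Bool (m + n)) {r : Event m} {s : Event n} →
               Agrees (take m v) r → Agrees (drop m v) s → Agrees v (r Vec.++ s)
agrees-split {m} v {r} {s} p q =
  subst (λ w → Agrees w (r Vec.++ s)) (take++drop≡id m v) (Pointwise.++⁺ p q)

agrees-homogeneous : ∀ {n} (g : Graph n) {b} (S : Subset n) →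
                     Homogeneous g b S → Agrees g (homogeneous b S)
agrees-homogeneous {zero} [] [] _ = []
agrees-homogeneous {suc n} g {b} (s ∷ S) hom = split s hom
  where
  rest : Homogeneous (drop n g) b S
  rest i j i∈ j∈ i≢j = hom (suc i) (suc j) (there i∈) (there j∈) (i≢j ∘ Fin.suc-injective)

  split : ∀ s → Homogeneous g b (s ∷ S) → Agrees g (homogeneous b (s ∷ S))
  split inside hom = agrees-split g
    (agrees-star (take n g) S λ j j∈ → hom zero (suc j) here (there j∈) λ ())
    (agrees-homogeneous (drop n g) S rest)
  split outside hom = agrees-split g
    (agrees-star (take n g) ⊥ λ j j∈ → contradiction j∈ ∉⊥)
    (agrees-homogeneous (drop n g) S rest)

subsets : ∀ n → ℕ → List (Subset n)
subsets n       zero    = ⊥ ∷ []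
subsets zero    (suc k) = []
subsets (suc n) (suc k) = map (inside ∷_) (subsets n k) ++ map (outside ∷_) (subsets n (suc k))

subsets-card : ∀ n k → All (λ S → ∣ S ∣ ≡ k) (subsets n k)
subsets-card n       zero    = ∣⊥∣≡0 n ∷ []
subsets-card zero    (suc k) = []
subsets-card (suc n) (suc k) = All.++⁺
  (All.map⁺ (All.map (cong suc) (subsets-card n k)))
  (All.map⁺ (subsets-card n (suc k)))

-- Pascal's recursion. The crude estimate `n ^ k` of the binomial coefficient is enough for the
-- union bound.
length-subsets : ∀ n k → length (subsets n k) ≤ n ^ k
length-subsets n       zero    = ≤-refl
length-subsets zero    (suc k) = z≤n
length-subsets (suc n) (suc k) = begin
  length (map (inside ∷_) (subsets n k) ++ map (outside ∷_) (subsets n (suc k)))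
    ≡⟨ length-++ (map (inside ∷_) (subsets n k)) ⟩
  length (map (inside ∷_) (subsets n k)) + length (map (outside ∷_) (subsets n (suc k)))
    ≡⟨ cong₂ _+_ (length-map _ (subsets n k)) (length-map _ (subsets n (suc k))) ⟩
  length (subsets n k) + length (subsets n (suc k))
    ≤⟨ +-mono-≤ (length-subsets n k) (length-subsets n (suc k)) ⟩
  n ^ k + n * n ^ k
    ≤⟨ *-monoʳ-≤ (suc n) (^-monoˡ-≤ k (n≤1+n n)) ⟩
  suc n ^ suc k ∎
  where open ≤-Reasoning

-- Homogeneity passes to subsets, so excluding homogeneous sets of exactly `k` vertices excludes all
-- larger ones.
subset-of-card : ∀ {n} k (S : Subset n) → k ≤ ∣ S ∣ → ∃[ S′ ] S′ ∈ˡ subsets n k × S′ ⊆ S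
subset-of-card zero    S _ = ⊥ , here refl , ⊥⊆
subset-of-card (suc k) (outside ∷ S) k≤
  with S′ , S′∈ , S′⊆ ← subset-of-card (suc k) S k≤ =
  outside ∷ S′ , ∈-++⁺ʳ _ (∈-map⁺ _ S′∈) , s⊆s S′⊆
subset-of-card (suc k) (inside ∷ S) (s≤s k≤)
  with S′ , S′∈ , S′⊆ ← subset-of-card k S k≤ =
  inside ∷ S′ , ∈-++⁺ˡ (∈-map⁺ _ S′∈) , s⊆s S′⊆

module _ (p : ℕ) where
  open Weights p

  -- Each vertex of `S` replaces a factor `suc p` by `bit b`. The power of `suc p` on the left
  -- avoids truncated subtraction in the exponent; the next lemmas are cleared of denominators in
  -- the same way.
  weight-star : ∀ {n} b (S : Subset n) →
    weight (star b S) * suc p ^ ∣ S ∣ ≡ suc p ^ n * bit b ^ ∣ S ∣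
  weight-star b [] = refl
  weight-star {suc n} b (outside ∷ S) = begin
    suc p * weight (star b S) * suc p ^ ∣ S ∣   ≡⟨ *-assoc (suc p) (weight (star b S)) _ ⟩
    suc p * (weight (star b S) * suc p ^ ∣ S ∣) ≡⟨ cong (suc p *_) (weight-star b S) ⟩
    suc p * (suc p ^ n * bit b ^ ∣ S ∣)         ≡⟨ *-assoc (suc p) (suc p ^ n) _ ⟨
    suc p ^ suc n * bit b ^ ∣ S ∣               ∎
    where open ≡-Reasoning
  weight-star {suc n} b (inside ∷ S) = begin
    bit b * weight (star b S) * (suc p * suc p ^ ∣ S ∣)
      ≡⟨ left (bit b) (weight (star b S)) (suc p) (suc p ^ ∣ S ∣) ⟩
    bit b * suc p * (weight (star b S) * suc p ^ ∣ S ∣)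
      ≡⟨ cong (bit b * suc p *_) (weight-star b S) ⟩
    bit b * suc p * (suc p ^ n * bit b ^ ∣ S ∣)
      ≡⟨ right (bit b) (suc p) (suc p ^ n) (bit b ^ ∣ S ∣) ⟩
    suc p ^ suc n * bit b ^ suc ∣ S ∣ ∎
    where
    open ≡-Reasoning
    left : ∀ c w q x → c * w * (q * x) ≡ c * q * (w * x)
    left = solve-∀
    right : ∀ c q x y → c * q * (x * y) ≡ q * x * (c * y)
    right = solve-∀

  weight-homogeneous : ∀ {n} b (S : Subset n) →
    weight (homogeneous b S) * suc p ^ pairs ∣ S ∣ ≡ suc p ^ pairs n * bit b ^ pairs ∣ S ∣
  weight-homogeneous b [] = refl
  weight-homogeneous {suc n} b (outside ∷ S) = begin
    weight (star b (⊥ {n}) Vec.++ homogeneous b S) * y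
      ≡⟨ cong (_* y) (weight-++ (star b (⊥ {n})) (homogeneous b S)) ⟩
    weight (star b (⊥ {n})) * weight (homogeneous b S) * y
      ≡⟨ cong (λ w → w * weight (homogeneous b S) * y) free ⟩
    suc p ^ n * weight (homogeneous b S) * y
      ≡⟨ *-assoc (suc p ^ n) _ y ⟩
    suc p ^ n * (weight (homogeneous b S) * y)
      ≡⟨ cong (suc p ^ n *_) (weight-homogeneous b S) ⟩
    suc p ^ n * (suc p ^ pairs n * bit b ^ pairs ∣ S ∣)
      ≡⟨ *-assoc (suc p ^ n) (suc p ^ pairs n) _ ⟨
    suc p ^ n * suc p ^ pairs n * bit b ^ pairs ∣ S ∣
      ≡⟨ cong (_* bit b ^ pairs ∣ S ∣) (^-distribˡ-+-* (suc p) n (pairs n)) ⟨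
    suc p ^ pairs (suc n) * bit b ^ pairs ∣ S ∣ ∎
    where
    open ≡-Reasoning
    y = suc p ^ pairs ∣ S ∣
    -- `∣ ⊥ ∣` does not compute for a variable `n`, so the case of zero fixed entries is transported
    -- along `∣⊥∣≡0`.
    free : weight (star b (⊥ {n})) ≡ suc p ^ n
    free = begin
      weight (star b (⊥ {n}))                        ≡⟨ *-identityʳ _ ⟨
      weight (star b (⊥ {n})) * suc p ^ 0
        ≡⟨ subst (λ k → weight (star b (⊥ {n})) * suc p ^ k ≡ suc p ^ n * bit b ^ k)
             (∣⊥∣≡0 n) (weight-star b (⊥ {n})) ⟩
      suc p ^ n * 1                                  ≡⟨ *-identityʳ _ ⟩
      suc p ^ n                                      ∎
  weight-homogeneous {suc n} b (inside ∷ S) = begin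
    weight (star b S Vec.++ homogeneous b S) * suc p ^ (∣ S ∣ + pairs ∣ S ∣)
      ≡⟨ cong₂ _*_ (weight-++ (star b S) (homogeneous b S)) (^-distribˡ-+-* (suc p) ∣ S ∣ _) ⟩
    weight (star b S) * weight (homogeneous b S) * (suc p ^ ∣ S ∣ * suc p ^ pairs ∣ S ∣)
      ≡⟨ interchange (weight (star b S)) _ _ _ ⟩
    weight (star b S) * suc p ^ ∣ S ∣ * (weight (homogeneous b S) * suc p ^ pairs ∣ S ∣)
      ≡⟨ cong₂ _*_ (weight-star b S) (weight-homogeneous b S) ⟩
    suc p ^ n * bit b ^ ∣ S ∣ * (suc p ^ pairs n * bit b ^ pairs ∣ S ∣)
      ≡⟨ interchange (suc p ^ n) _ _ _ ⟩
    suc p ^ n * suc p ^ pairs n * (bit b ^ ∣ S ∣ * bit b ^ pairs ∣ S ∣)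
      ≡⟨ cong₂ _*_ (^-distribˡ-+-* (suc p) n _) (^-distribˡ-+-* (bit b) ∣ S ∣ _) ⟨
    suc p ^ pairs (suc n) * bit b ^ pairs ∣ inside ∷ S ∣ ∎
    where
    open ≡-Reasoning
    interchange : ∀ a b c d → a * b * (c * d) ≡ a * c * (b * d)
    interchange = solve-∀

  totalWeight-homogeneous : ∀ {n k} b {Ss : List (Subset n)} → All (λ S → ∣ S ∣ ≡ k) Ss →
    totalWeight (map (homogeneous b) Ss) * suc p ^ pairs k
      ≡ length Ss * bit b ^ pairs k * suc p ^ pairs n
  totalWeight-homogeneous b [] = refl
  totalWeight-homogeneous {n} {k} b {S ∷ Ss} (refl ∷ cs) = begin
    (weight (homogeneous b S) + totalWeight (map (homogeneous b) Ss)) * suc p ^ pairs k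
      ≡⟨ *-distribʳ-+ (suc p ^ pairs k) (weight (homogeneous b S)) _ ⟩
    weight (homogeneous b S) * suc p ^ pairs k
      + totalWeight (map (homogeneous b) Ss) * suc p ^ pairs k
      ≡⟨ cong₂ _+_ (weight-homogeneous b S) (totalWeight-homogeneous b cs) ⟩
    suc p ^ pairs n * bit b ^ pairs k + length Ss * bit b ^ pairs k * suc p ^ pairs n
      ≡⟨ collect (suc p ^ pairs n) (bit b ^ pairs k) (length Ss) ⟩
    suc (length Ss) * bit b ^ pairs k * suc p ^ pairs n ∎
    where
    open ≡-Reasoning
    collect : ∀ x y l → x * y + l * y * x ≡ suc l * y * x
    collect = solve-∀

  -- A record, so that Agda does not unfold the powers when comparing types.
  record Rare (n : ℕ) (b : Bool) (k : ℕ) : Set where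
    constructor mkRare
    field
      twice-expected<1 : 2 * (n ^ k * bit b ^ pairs k) < suc p ^ pairs k

  -- Union bound: at most `n ^ k` sets, each homogeneous with probability
  -- `(bit b / suc p) ^ pairs k`, so the expected number of homogeneous `k`-sets is below one half.
  rare-weight : ∀ {n k} b → Rare n b k →
    2 * totalWeight (map (homogeneous b) (subsets n k)) < suc p ^ pairs n
  rare-weight {n} {k} b (mkRare rare) = *-cancelʳ-< (suc p ^ pairs k) _ _ (begin-strict
    2 * W * suc p ^ pairs k                          ≡⟨ *-assoc 2 W _ ⟩
    2 * (W * suc p ^ pairs k)
      ≡⟨ cong (2 *_) (totalWeight-homogeneous b (subsets-card n k)) ⟩
    2 * (length (subsets n k) * bit b ^ pairs k * suc p ^ pairs n)
      ≡⟨ *-assoc 2 (length (subsets n k) * bit b ^ pairs k) _ ⟨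
    2 * (length (subsets n k) * bit b ^ pairs k) * suc p ^ pairs n
      ≤⟨ *-monoˡ-≤ (suc p ^ pairs n) (*-monoʳ-≤ 2
           (*-monoˡ-≤ (bit b ^ pairs k) (length-subsets n k))) ⟩
    2 * (n ^ k * bit b ^ pairs k) * suc p ^ pairs n
      <⟨ *-monoˡ-< (suc p ^ pairs n) {{m^n≢0 (suc p) (pairs n)}} rare ⟩
    suc p ^ pairs k * suc p ^ pairs n                ≡⟨ *-comm (suc p ^ pairs k) _ ⟩
    suc p ^ pairs n * suc p ^ pairs k                ∎)
    where
    open ≤-Reasoning
    W = totalWeight (map (homogeneous b) (subsets n k))

  -- Cliques and independent sets each contribute less than one half to the expected number of bad
  -- events, so `avoid` applies to the concatenated list.
  ramsey-lower : ∀ {n s t} → Rare n true s → Rare n false t →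
    ∃[ g ] (∀ S → Homogeneous {n} g true S → ∣ S ∣ < s) ×
           (∀ S → Homogeneous {n} g false S → ∣ S ∣ < t)
  ramsey-lower {n} {s} {t} rs rt = extract (avoid (events true s ++ events false t) total)
    where
    events : Bool → ℕ → List (Event (pairs n))
    events b k = map (homogeneous b) (subsets n k)

    total : totalWeight (events true s ++ events false t) < suc p ^ pairs n
    total = *-cancelˡ-< 2 _ _ (begin-strict
      2 * totalWeight (events true s ++ events false t)
        ≡⟨ cong (2 *_) (trans (cong sum (map-++ weight (events true s) (events false t)))
             (sum-++ (map weight (events true s)) _)) ⟩
      2 * (totalWeight (events true s) + totalWeight (events false t))
        ≡⟨ *-distribˡ-+ 2 (totalWeight (events true s)) _ ⟩
      2 * totalWeight (events true s) + 2 * totalWeight (events false t)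
        <⟨ +-mono-< (rare-weight true rs) (rare-weight false rt) ⟩
      suc p ^ pairs n + suc p ^ pairs n
        ≡⟨ cong (suc p ^ pairs n +_) (sym (+-identityʳ _)) ⟩
      2 * suc p ^ pairs n ∎)
      where open ≤-Reasoning

    small : ∀ g b {k} → All (λ r → ¬ Agrees g r) (events b k) →
            ∀ S → Homogeneous {n} g b S → ∣ S ∣ < k
    small g b {k} none S hom with ∣ S ∣ <? k
    ... | yes lt = lt
    ... | no ≮k with S′ , S′∈ , S′⊆S ← subset-of-card k S (≮⇒≥ ≮k) =
      contradiction
        (agrees-homogeneous g S′ λ i j i∈ j∈ → hom i j (S′⊆S i∈) (S′⊆S j∈))
        (All.lookup none (∈-map⁺ _ S′∈))

    extract : ∃[ g ] All (λ r → ¬ Agrees g r) (events true s ++ events false t) → _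
    extract (g , av) =
      g , small g true (All.++⁻ˡ (events true s) av) , small g false (All.++⁻ʳ (events true s) av)

-- Estimates for the clique and independence probabilities

-- For positive `p` this is Bernoulli's inequality `1 + n/p ≤ (1 + 1/p)^n`, multiplied by
-- `p ^ suc n`.
bernoulli : ∀ p n → p ^ n * (p + n) ≤ p * suc p ^ n
bernoulli p zero    = ≤-reflexive (base p)
  where
  base : ∀ p → 1 * (p + 0) ≡ p * 1
  base = solve-∀
bernoulli p (suc n) = begin
  p * p ^ n * (p + suc n)               ≤⟨ m≤m+n _ (p ^ n * n) ⟩
  p * p ^ n * (p + suc n) + p ^ n * n   ≡⟨ expand p n (p ^ n) ⟩
  suc p * (p ^ n * (p + n))             ≤⟨ *-monoʳ-≤ (suc p) (bernoulli p n) ⟩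
  suc p * (p * suc p ^ n)               ≡⟨ exchange (suc p) p (suc p ^ n) ⟩
  p * suc p ^ suc n                     ∎
  where
  open ≤-Reasoning
  expand : ∀ p n x → p * x * (p + suc n) + x * n ≡ suc p * (x * (p + n))
  expand = solve-∀
  exchange : ∀ x y z → x * (y * z) ≡ y * (x * z)
  exchange = solve-∀

-- This is `(1 - 1/q)^q ≤ 1/2` for `q = suc p`: Bernoulli with exponent `q` gives the factor
-- `p + q ≥ 2p`. Cancelling `p` forces the separate case of zero.
2*p^[1+p]≤[1+p]^[1+p] : ∀ p → 2 * p ^ suc p ≤ suc p ^ suc p
2*p^[1+p]≤[1+p]^[1+p] zero      = z≤n
2*p^[1+p]≤[1+p]^[1+p] p@(suc _) = *-cancelˡ-≤ p (begin
  p * (2 * p ^ suc p)        ≡⟨ rearrange p (p ^ suc p) ⟩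
  p ^ suc p * (p + p)        ≤⟨ *-monoʳ-≤ (p ^ suc p) (+-monoʳ-≤ p (n≤1+n p)) ⟩
  p ^ suc p * (p + suc p)    ≤⟨ bernoulli p (suc p) ⟩
  p * suc p ^ suc p          ∎)
  where
  open ≤-Reasoning
  rearrange : ∀ p x → p * (2 * x) ≡ x * (p + p)
  rearrange = solve-∀

-- Among `m` factors `p / suc p`, form `s` blocks of length `suc p`. Each block is at most one half,
-- and the `r` remaining factors are at most one.
2^s*p^m≤[1+p]^m : ∀ p s {m} → suc p * s ≤ m → 2 ^ s * p ^ m ≤ suc p ^ m
2^s*p^m≤[1+p]^m p s {m} qs≤m
  with r , refl ← m≤n⇒∃[o]m+o≡n qs≤m = begin
  2 ^ s * p ^ (suc p * s + r)
    ≡⟨ cong (2 ^ s *_) (^-distribˡ-+-* p (suc p * s) r) ⟩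
  2 ^ s * (p ^ (suc p * s) * p ^ r)
    ≡⟨ *-assoc (2 ^ s) _ _ ⟨
  2 ^ s * p ^ (suc p * s) * p ^ r
    ≡⟨ cong (λ x → 2 ^ s * x * p ^ r) (^-*-assoc p (suc p) s) ⟨
  2 ^ s * (p ^ suc p) ^ s * p ^ r
    ≡⟨ cong (_* p ^ r) (^-distribʳ-* s 2 (p ^ suc p)) ⟨
  (2 * p ^ suc p) ^ s * p ^ r
    ≤⟨ *-mono-≤ (^-monoˡ-≤ s (2*p^[1+p]≤[1+p]^[1+p] p)) (^-monoˡ-≤ r (n≤1+n p)) ⟩
  (suc p ^ suc p) ^ s * suc p ^ r
    ≡⟨ cong (_* suc p ^ r) (^-*-assoc (suc p) (suc p) s) ⟩
  suc p ^ (suc p * s) * suc p ^ r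
    ≡⟨ ^-distribˡ-+-* (suc p) (suc p * s) r ⟨
  suc p ^ (suc p * s + r) ∎
  where
  open ≤-Reasoning
  ^-distribʳ-* : ∀ n x y → (x * y) ^ n ≡ x ^ n * y ^ n
  ^-distribʳ-* zero    x y = refl
  ^-distribʳ-* (suc n) x y rewrite ^-distribʳ-* n x y = [m*n]*[o*p]≡[m*o]*[n*p] x y _ _

2*pairs[1+j]≡j*[1+j] : ∀ j → 2 * pairs (suc j) ≡ j * suc j
2*pairs[1+j]≡j*[1+j] zero    = refl
2*pairs[1+j]≡j*[1+j] (suc j) = begin
  2 * (suc j + pairs (suc j))     ≡⟨ *-distribˡ-+ 2 (suc j) (pairs (suc j)) ⟩
  2 * suc j + 2 * pairs (suc j)   ≡⟨ cong (2 * suc j +_) (2*pairs[1+j]≡j*[1+j] j) ⟩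
  2 * suc j + j * suc j           ≡⟨ collect j ⟩
  suc j * suc (suc j)             ∎
  where
  open ≡-Reasoning
  collect : ∀ j → 2 * suc j + j * suc j ≡ suc j * suc (suc j)
  collect = solve-∀

n≤2^n : ∀ n → n ≤ 2 ^ n
n≤2^n zero    = z≤n
n≤2^n (suc n) = +-mono-≤ (m^n>0 2 n) (≤-trans (n≤2^n n) (≤-reflexive (sym (+-identityʳ _))))

-- With `q ^ 4` vertices and edge probability `1/q`, the expected number of `k`-cliques is at most
-- `q ^ (4 * k)` divided by `q ^ pairs k`. Since `2 ≤ q`, the factor two costs one more `q`, hence
-- the `suc` in the hypothesis.
rare-clique : ∀ {p} b k → suc p ≡ 2 ^ suc b → suc (4 * k) < pairs k →
              Rare p ((2 ^ suc b) ^ 4) true k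
rare-clique {p} b k eq lt = mkRare (begin-strict
  2 * ((q ^ 4) ^ k * 1 ^ pairs k)  ≡⟨ cong (λ x → 2 * ((q ^ 4) ^ k * x)) (^-zeroˡ (pairs k)) ⟩
  2 * ((q ^ 4) ^ k * 1)            ≡⟨ cong (2 *_) (*-identityʳ ((q ^ 4) ^ k)) ⟩
  2 * (q ^ 4) ^ k                  ≡⟨ cong (2 *_) (^-*-assoc q 4 k) ⟩
  2 * q ^ (4 * k)                  ≤⟨ *-monoˡ-≤ (q ^ (4 * k)) (^-monoʳ-≤ 2 {1} {suc b} (s≤s z≤n)) ⟩
  q ^ suc (4 * k)                  <⟨ ^-monoʳ-< q (^-monoʳ-< 2 ≤-refl {0} {suc b} (s≤s z≤n)) lt ⟩
  q ^ pairs k                      ≡⟨ cong (_^ pairs k) eq ⟨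
  suc p ^ pairs k                  ∎)
  where
  open ≤-Reasoning
  q = 2 ^ suc b

-- (1 - 1/q)^q ≤ 1/2 with q = 2 ^ b bounds the probability that a given set of
-- 1 + j vertices is independent by 2 ^ -(4b (1+j) + 2).
rare-independent : ∀ {p} b → suc p ≡ 2 ^ b → Rare p ((2 ^ b) ^ 4) false (suc (2 ^ b * (8 * b + 4)))
rare-independent {p} b eq = mkRare (*-cancelˡ-< 2 _ _ (begin-strict
  2 * (2 * (((2 ^ b) ^ 4) ^ k * p ^ pairs k))
    ≡⟨ cong (λ x → 2 * (2 * (x * p ^ pairs k)))
         (trans (cong (_^ k) (^-*-assoc 2 b 4)) (^-*-assoc 2 (b * 4) k)) ⟩
  2 * (2 * (2 ^ (b * 4 * k) * p ^ pairs k))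
    ≡⟨ rearrange (2 ^ (b * 4 * k)) (p ^ pairs k) ⟩
  2 ^ s * p ^ pairs k
    ≤⟨ 2^s*p^m≤[1+p]^m p s many ⟩
  suc p ^ pairs k
    <⟨ m<m+n _ (m^n>0 (suc p) (pairs k)) ⟩
  suc p ^ pairs k + suc p ^ pairs k
    ≡⟨ cong (suc p ^ pairs k +_) (+-identityʳ _) ⟨
  2 * suc p ^ pairs k ∎))
  where
  open ≤-Reasoning
  j k s : ℕ
  j = 2 ^ b * (8 * b + 4)
  k = suc j
  s = 2 + b * 4 * k

  rearrange : ∀ x y → 2 * (2 * (x * y)) ≡ 2 * (2 * x) * y
  rearrange = solve-∀

  many : suc p * s ≤ pairs k
  many = *-cancelˡ-≤ 2 (begin
    2 * (suc p * s)              ≡⟨ cong (λ x → 2 * (x * s)) eq ⟩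
    -- By the choice of `j`, twice `pairs k` is `q * (8b + 4) * (1 + j)` with `q = 2 ^ b`. It
    -- exceeds `2 * q * s` by exactly `4 * q * j`.
    2 * (2 ^ b * s)              ≤⟨ m≤m+n _ (4 * (2 ^ b * j)) ⟩
    2 * (2 ^ b * s) + 4 * (2 ^ b * j)
                                 ≡⟨ expand (2 ^ b) b j ⟩
    2 ^ b * (8 * b + 4) * k      ≡⟨ 2*pairs[1+j]≡j*[1+j] j ⟨
    2 * pairs k                  ∎)
    where
    expand : ∀ q b j → 2 * (q * (2 + b * 4 * suc j)) + 4 * (q * j) ≡ q * (8 * b + 4) * suc j
    expand = solve-∀

RamseyGraph : ℕ → ℕ → ℕ → Set
RamseyGraph n s t = ∃[ g ] (∀ S → Homogeneous {n} g true S → ∣ S ∣ ≤ s) ×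
                           (∀ S → Homogeneous {n} g false S → ∣ S ∣ ≤ t)

rare⇒ramseyGraph : ∀ p n s {t t′} → Rare p n true s → Rare p n false (suc t) → t ≤ t′ →
                   RamseyGraph n s t′
rare⇒ramseyGraph p n s {t} clique independent t≤t′ =
  let g , cliques , independents = ramsey-lower p {n} {s} {suc t} clique independent
  in g , (λ S hom → <⇒≤ (cliques S hom)) ,
     λ S hom → ≤-trans (≤-pred (independents S hom)) t≤t′

-- With `N = q ^ 4` the last parameter is 12 times the square root of `N`. The independence bound
-- obtained is only `q` times a logarithm of `q`, and the logarithm is generously replaced by `q`.
ramseyGraph : ∀ b → RamseyGraph ((2 ^ suc b) ^ 4) 10 (12 * (2 ^ suc b) ^ 2)
ramseyGraph b =
  rare⇒ramseyGraph (pred q) (q ^ 4) 10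
    (rare-clique b 10 q≡ 41<pairs[10]) (rare-independent (suc b) q≡) bound
  where
  open ≤-Reasoning
  q = 2 ^ suc b
  q≡ = suc-pred q {{m^n≢0 2 (suc b)}}
  -- Ten is the least `k` with `4k + 1 < pairs k`; here `pairs 10` is 45.
  41<pairs[10] : 41 < pairs 10
  41<pairs[10] = m≤m+n 42 3
  bound : q * (8 * suc b + 4) ≤ 12 * q ^ 2
  bound = begin
    q * (8 * suc b + 4)
      ≤⟨ *-monoʳ-≤ q (+-mono-≤ (*-monoʳ-≤ 8 (n≤2^n (suc b))) (*-monoʳ-≤ 4 (m^n>0 2 (suc b)))) ⟩
    q * (8 * q + 4 * q)
      ≡⟨ collect q ⟩
    12 * q ^ 2 ∎
    where
    collect : ∀ q → q * (8 * q + 4 * q) ≡ 12 * (q * (q * 1))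
    collect = solve-∀

-- The lower bound

comprehension : ∀ {n} {P : Pred (Fin n) 0ℓ} → Decidable P → Subset n
comprehension P? = tabulate (does ∘ P?)

module _ {n} {P : Pred (Fin n) 0ℓ} (P? : Decidable P) where

  ∈-comprehension⁺ : ∀ {i} → P i → i ∈ comprehension P?
  ∈-comprehension⁺ {i} p =
    lookup⇒[]= i _ (trans (lookup∘tabulate _ i) (dec-true (P? i) p))

  ∈-comprehension⁻ : ∀ {i} → i ∈ comprehension P? → P i
  ∈-comprehension⁻ {i} i∈
    with P? i | trans (sym (lookup∘tabulate (does ∘ P?) i)) ([]=⇒lookup i∈)
  ... | yes p | _ = p
  ... | no _  | ()

∣p∣≤∣q∣+∣p─q∣ : ∀ {n} (p q : Subset n) → ∣ p ∣ ≤ ∣ q ∣ + ∣ p ─ q ∣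
∣p∣≤∣q∣+∣p─q∣ []            []            = z≤n
∣p∣≤∣q∣+∣p─q∣ (inside ∷ p)  (inside ∷ q)  = s≤s (∣p∣≤∣q∣+∣p─q∣ p q)
∣p∣≤∣q∣+∣p─q∣ (outside ∷ p) (inside ∷ q)  = m≤n⇒m≤1+n (∣p∣≤∣q∣+∣p─q∣ p q)
∣p∣≤∣q∣+∣p─q∣ (inside ∷ p)  (outside ∷ q) =
  ≤-trans (s≤s (∣p∣≤∣q∣+∣p─q∣ p q)) (≤-reflexive (sym (+-suc ∣ q ∣ _)))
∣p∣≤∣q∣+∣p─q∣ (outside ∷ p) (outside ∷ q) = ∣p∣≤∣q∣+∣p─q∣ p q

x∈p─q⇒x∉q : ∀ {n} (p q : Subset n) {x} → x ∈ p ─ q → x ∉ q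
x∈p─q⇒x∉q (_ ∷ p) (inside ∷ q)  (there x∈) (there x∈q) = x∈p─q⇒x∉q p q x∈ x∈q
x∈p─q⇒x∉q (_ ∷ p) (outside ∷ q) (there x∈) (there x∈q) = x∈p─q⇒x∉q p q x∈ x∈q

-- Induction on the index set: remove `F zero` from `S` when zero is an index, at a cost of at most
-- `h` elements; what is left is covered by the remaining sets.
card-cover : ∀ {m n h} (A : Subset m) (F : Fin m → Subset n) (S : Subset n) →
             (∀ {i} → i ∈ S → ∃[ a ] a ∈ A × i ∈ F a) →
             (∀ a → ∣ F a ∣ ≤ h) → ∣ S ∣ ≤ ∣ A ∣ * h
card-cover {n = n} [] F S cover _ = ≤-trans (p⊆q⇒∣p∣≤∣q∣ S⊆⊥) (≤-reflexive (∣⊥∣≡0 n))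
  where
  S⊆⊥ : S ⊆ ⊥
  S⊆⊥ i∈ with () ← proj₁ (cover i∈)
card-cover (outside ∷ A) F S cover bound = card-cover A (F ∘ suc) S cover′ (bound ∘ suc)
  where
  cover′ : ∀ {i} → i ∈ S → ∃[ a ] a ∈ A × i ∈ F (suc a)
  cover′ i∈ with suc a , there a∈ , i∈Fa ← cover i∈ = a , a∈ , i∈Fa
card-cover (inside ∷ A) F S cover bound = ≤-trans (∣p∣≤∣q∣+∣p─q∣ S (F zero))
  (+-mono-≤ (bound zero) (card-cover A (F ∘ suc) (S ─ F zero) cover′ (bound ∘ suc)))
  where
  cover′ : ∀ {i} → i ∈ S ─ F zero → ∃[ a ] a ∈ A × i ∈ F (suc a)
  cover′ i∈ with cover (p─q⊆p S (F zero) i∈)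
  ... | suc a , there a∈ , i∈Fa = a , a∈ , i∈Fa
  ... | zero , here , i∈F = contradiction i∈F (x∈p─q⇒x∉q S (F zero) i∈)

module _ {m n} (f : Fin n → Fin m) (S : Subset n) where

  private
    hits? : ∀ a → Decidable (λ i → i ∈ S × f i ≡ a)
    hits? a i = (i ∈? S) ×-dec (f i Fin.≟ a)

  fibre : Fin m → Subset n
  fibre a = comprehension (hits? a)

  image : Subset m
  image = comprehension (λ a → any? (hits? a))

  ∈-fibre⁻ : ∀ {a i} → i ∈ fibre a → i ∈ S × f i ≡ a
  ∈-fibre⁻ = ∈-comprehension⁻ (hits? _)

  ∈-image⁻ : ∀ {a} → a ∈ image → ∃[ i ] i ∈ S × f i ≡ a
  ∈-image⁻ = ∈-comprehension⁻ (λ a → any? (hits? a))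

  card-fibres : ∀ {h} → (∀ a → ∣ fibre a ∣ ≤ h) → ∣ S ∣ ≤ ∣ image ∣ * h
  card-fibres = card-cover image fibre S λ {i} i∈ →
    f i , ∈-comprehension⁺ (λ a → any? (hits? a)) (i , i∈ , refl) ,
    ∈-comprehension⁺ (hits? _) (i∈ , refl)

  card-injective : (∀ {i j} → i ∈ S → j ∈ S → f i ≡ f j → i ≡ j) → ∣ S ∣ ≤ ∣ image ∣
  card-injective inj = subst (∣ S ∣ ≤_) (*-identityʳ _) (card-fibres λ a → subsingleton (fibre a)
    λ i∈ j∈ → let (i∈S , fi≡a) = ∈-fibre⁻ i∈; (j∈S , fj≡a) = ∈-fibre⁻ j∈
              in inj i∈S j∈S (trans fi≡a (sym fj≡a)))
    where
    subsingleton : (T : Subset n) → (∀ {i j} → i ∈ T → j ∈ T → i ≡ j) → ∣ T ∣ ≤ 1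
    subsingleton T eq with nonempty? T
    ... | yes (i , i∈) = ≤-trans
      (p⊆q⇒∣p∣≤∣q∣ {q = ⁅ i ⁆} λ j∈ → subst (_∈ ⁅ i ⁆) (eq i∈ j∈) (x∈⁅x⁆ i))
      (≤-reflexive (∣⁅x⁆∣≡1 i))
    ... | no empty = ≤-trans (p⊆q⇒∣p∣≤∣q∣ {q = ⊥} λ j∈ → contradiction (_ , j∈) empty)
      (≤-trans (≤-reflexive (∣⊥∣≡0 n)) z≤n)

-- Greedy choice: vertex zero joins the set found among the others exactly when it is related to
-- none of its members. Maximality is recorded as domination, the form in which it yields a cover.
maximal-independent : ∀ {n} {R : Rel (Fin n) 0ℓ} → Binary.Symmetric R → Binary.Decidable R →
  ∃[ I ] (∀ {i j} → i ∈ I → j ∈ I → i ≢ j → ¬ R i j) ×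
         (∀ i → ∃[ j ] j ∈ I × (j ≡ i ⊎ R j i))
maximal-independent {zero} _ _ = [] , (λ ()) , λ ()
maximal-independent {suc n} {R} R-sym R?
  with I , indep , dom ←
         maximal-independent {n} {λ i j → R (suc i) (suc j)} R-sym (λ i j → R? (suc i) (suc j))
  with any? (λ j → (j ∈? I) ×-dec R? (suc j) zero)
... | yes (j , j∈ , Rj0) = outside ∷ I , indep′ , dom′
  where
  indep′ : ∀ {i j} → i ∈ outside ∷ I → j ∈ outside ∷ I → i ≢ j → ¬ R i j
  indep′ (there i∈) (there j∈) i≢j = indep i∈ j∈ (i≢j ∘ cong suc)

  dom′ : ∀ i → ∃[ j ] j ∈ outside ∷ I × (j ≡ i ⊎ R j i)
  dom′ zero = suc j , there j∈ , inj₂ Rj0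
  dom′ (suc i) with dom i
  ... | k , k∈ , inj₁ refl = suc k , there k∈ , inj₁ refl
  ... | k , k∈ , inj₂ Rki  = suc k , there k∈ , inj₂ Rki
... | no none = inside ∷ I , indep′ , dom′
  where
  indep′ : ∀ {i j} → i ∈ inside ∷ I → j ∈ inside ∷ I → i ≢ j → ¬ R i j
  indep′ here       here       i≢j _ = i≢j refl
  indep′ here       (there j∈) _   r = none (_ , j∈ , R-sym r)
  indep′ (there i∈) here       _   r = none (_ , i∈ , r)
  indep′ (there i∈) (there j∈) i≢j   = indep i∈ j∈ (i≢j ∘ cong suc)

  dom′ : ∀ i → ∃[ j ] j ∈ inside ∷ I × (j ≡ i ⊎ R j i)
  dom′ zero = zero , here , inj₁ refl
  dom′ (suc i) with dom i
  ... | k , k∈ , inj₁ refl = suc k , there k∈ , inj₁ refl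
  ... | k , k∈ , inj₂ Rki  = suc k , there k∈ , inj₂ Rki

≢red⇒ : ∀ {x} → x ≢ red → x ≡ blue ⊎ x ≡ yellow
≢red⇒ {red}    x≢ = contradiction refl x≢
≢red⇒ {blue}   _  = inj₁ refl
≢red⇒ {yellow} _  = inj₂ refl

≢blue⇒ : ∀ {x} → x ≢ blue → x ≡ red ⊎ x ≡ yellow
≢blue⇒ {red}    _  = inj₁ refl
≢blue⇒ {blue}   x≢ = contradiction refl x≢
≢blue⇒ {yellow} _  = inj₂ refl

∣S∣≤h₂ : ∀ {n} (c : Coloring n) (S : Subset n) → AtMostTwoColors c S → ∣ S ∣ ≤ h₂ c
∣S∣≤h₂ c S two = proj₂ (h₂-spec c) ∣ S ∣ (S , refl , two)

n≤h₂*h₂ : ∀ {n} ((c , _) : Forb n ℋ) → n ≤ h₂ c * h₂ c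
n≤h₂*h₂ {n} (c , avoids)
  with I , indep , dom ← maximal-independent {n} {λ i j → color c i j ≡ red}
         (λ {i} {j} eq → trans (symmetric c j i) eq) (λ i j → color c i j ≟ red) = begin
  n                 ≡⟨ ∣⊤∣≡n n ⟨
  ∣ ⊤ {n} ∣         ≤⟨ card-cover I nbhd ⊤ cover (λ v → ∣S∣≤h₂ c (nbhd v) (nbhd-two v)) ⟩
  ∣ I ∣ * h₂ c      ≤⟨ *-monoˡ-≤ (h₂ c) (∣S∣≤h₂ c I I-two) ⟩
  h₂ c * h₂ c       ∎
  where
  open ≤-Reasoning

  I-two : AtMostTwoColors c I
  I-two = blue , yellow , λ i j i∈ j∈ i≢j → ≢red⇒ (indep i∈ j∈ i≢j)

  red? : ∀ v → Decidable (λ i → v ≡ i ⊎ color c v i ≡ red)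
  red? v i = (v Fin.≟ i) ⊎-dec (color c v i ≟ red)

  nbhd : Fin n → Subset n
  nbhd v = comprehension (red? v)

  cover : ∀ {i} → i ∈ ⊤ → ∃[ v ] v ∈ I × i ∈ nbhd v
  cover {i} _ = let v , v∈ , r = dom i in v , v∈ , ∈-comprehension⁺ (red? v) r

  no-blue : ∀ {v i j} → v ≡ i ⊎ color c v i ≡ red → v ≡ j ⊎ color c v j ≡ red →
            i ≢ j → color c i j ≢ blue
  no-blue (inj₁ refl) (inj₁ refl) i≢j _ = i≢j refl
  no-blue (inj₁ refl) (inj₂ r)    _   b with () ← trans (sym r) b
  no-blue {i = i} {j} (inj₂ r) (inj₁ refl) _ b with () ← trans (sym r) (trans (symmetric c j i) b)
  -- Diagonal colors are arbitrary, so `color c v i ≡ red` does not exclude `v ≡ i`. In the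
  -- coincident cases one edge would be both red and blue; otherwise `v`, `i`, `j` form the pattern
  -- `rrb`.
  no-blue {v} {i} {j} (inj₂ r) (inj₂ r′) i≢j b with v Fin.≟ i | v Fin.≟ j
  ... | yes refl | _        with () ← trans (sym r′) b
  ... | no _     | yes refl with () ← trans (sym r) (trans (symmetric c v i) b)
  ... | no v≢i   | no v≢j   with ¬rrb ∷ _ ← avoids v i j v≢i i≢j v≢j
    rewrite r | r′ | b = ¬rrb (prep red (swap blue red ↭-refl))

  nbhd-two : ∀ v → AtMostTwoColors c (nbhd v)
  nbhd-two v = red , yellow , λ i j i∈ j∈ i≢j →
    ≢blue⇒ (no-blue (∈-comprehension⁻ (red? v) i∈) (∈-comprehension⁻ (red? v) j∈) i≢j)

-- The upper bound

Clean : List Color → Set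
Clean xs = All (λ p → ¬ (xs ↭ toList p)) ℋ

clean? : ∀ xs → Dec (Clean xs)
clean? xs = All.all? (λ p → ¬? (xs ↭? toList p)) ℋ

clean-resp-↭ : ∀ {xs ys} → xs ↭ ys → Clean xs → Clean ys
clean-resp-↭ xs↭ys = All.map λ ¬p ys↭p → ¬p (↭-trans xs↭ys ys↭p)

-- Both patterns of `ℋ` contain red as well as blue, so a triangle lacking either color is harmless.
clean-without-red : ∀ {xs} → All (_≢ red) xs → Clean xs
clean-without-red no-red = missing (here refl) ∷ missing (here refl) ∷ []
  where
  missing : ∀ {ys} → red ∈ˡ ys → ¬ (_ ↭ ys)
  missing r∈ xs↭ys = All.lookup no-red (∈-resp-↭ (↭-sym xs↭ys) r∈) refl

clean-without-blue : ∀ {xs} → All (_≢ blue) xs → Clean xs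
clean-without-blue no-blue = missing (there (there (here refl))) ∷ missing (there (here refl)) ∷ []
  where
  missing : ∀ {ys} → blue ∈ˡ ys → ¬ (_ ↭ ys)
  missing b∈ xs↭ys = All.lookup no-blue (∈-resp-↭ (↭-sym xs↭ys) b∈) refl

inner outer : Bool → Color
inner e = if e then yellow else red
outer e = if e then yellow else blue

inner≢blue : ∀ e → inner e ≢ blue
inner≢blue true  ()
inner≢blue false ()

outer≢red : ∀ e → outer e ≢ red
outer≢red true  ()
outer≢red false ()

-- If exactly two vertices of a triangle share a block, its two outer edges join the same pair of
-- blocks and so have equal color. Only four color triples remain, and they are checked by
-- computation.
clean-inner-outer : ∀ d e → Clean (inner d ∷ outer e ∷ outer e ∷ [])
clean-inner-outer true  true  = from-yes (clean? (yellow ∷ yellow ∷ yellow ∷ []))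
clean-inner-outer true  false = from-yes (clean? (yellow ∷ blue ∷ blue ∷ []))
clean-inner-outer false true  = from-yes (clean? (red ∷ yellow ∷ yellow ∷ []))
clean-inner-outer false false = from-yes (clean? (red ∷ blue ∷ blue ∷ []))

missing-color : ∀ (x y : Color) → ∃[ z ] x ≢ z × y ≢ z
missing-color red    red    = blue , (λ ()) , λ ()
missing-color red    blue   = yellow , (λ ()) , λ ()
missing-color red    yellow = blue , (λ ()) , λ ()
missing-color blue   red    = yellow , (λ ()) , λ ()
missing-color blue   blue   = red , (λ ()) , λ ()
missing-color blue   yellow = red , (λ ()) , λ ()
missing-color yellow red    = blue , (λ ()) , λ ()
missing-color yellow blue   = red , (λ ()) , λ ()
missing-color yellow yellow = red , (λ ()) , λ ()

-- `α` gives the block of a vertex and `β` its place in the block. Joint injectivity in place of a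
-- bijection with all `m * m` pairs admits every smaller number of vertices.
module Blowup {m n} (g : Graph m) (α β : Fin n → Fin m)
              (injective : ∀ {i j} → α i ≡ α j → β i ≡ β j → i ≡ j) where

  adj : Fin m → Fin m → Bool
  adj = adjacent {m} g

  hue : Fin n → Fin n → Color
  hue i j = if does (α i Fin.≟ α j) then inner (adj (β i) (β j)) else outer (adj (α i) (α j))

  hue-inner : ∀ {i j} → α i ≡ α j → hue i j ≡ inner (adj (β i) (β j))
  hue-inner {i} {j} eq rewrite dec-true (α i Fin.≟ α j) eq = refl

  hue-outer : ∀ {i j} → α i ≢ α j → hue i j ≡ outer (adj (α i) (α j))
  hue-outer {i} {j} neq rewrite dec-false (α i Fin.≟ α j) neq = refl

  hue-sym : ∀ i j → hue i j ≡ hue j i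
  hue-sym i j with α i Fin.≟ α j
  ... | yes eq = trans (cong inner (adjacent-sym {m} g (β i) (β j))) (sym (hue-inner (sym eq)))
  ... | no neq = trans (cong outer (adjacent-sym {m} g (α i) (α j))) (sym (hue-outer (neq ∘ sym)))

  coloring : Coloring n
  coloring = mkColoring hue hue-sym

  -- Inside one block there is no blue, and across three blocks no red. The three ways of meeting
  -- two blocks reduce to `clean-inner-outer` by moving the inner edge to the front.
  clean-triangle : ∀ {i j k} → Dec (α i ≡ α j) → Dec (α j ≡ α k) → Dec (α i ≡ α k) →
                   Clean (hue i j ∷ hue j k ∷ hue i k ∷ [])
  clean-triangle (yes ij) (yes jk) _
    rewrite hue-inner ij | hue-inner jk | hue-inner (trans ij jk) =
    clean-without-blue (inner≢blue _ ∷ inner≢blue _ ∷ inner≢blue _ ∷ [])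
  clean-triangle {i} {j} {k} (yes ij) (no jk) _
    rewrite hue-inner ij | hue-outer jk | hue-outer {i} {k} (jk ∘ trans (sym ij)) | ij =
    clean-inner-outer (adj (β i) (β j)) (adj (α j) (α k))
  clean-triangle {i} {j} {k} (no ij) (yes jk) _
    rewrite hue-outer ij | hue-inner jk | hue-outer {i} {k} (λ ik → ij (trans ik (sym jk))) | jk =
    clean-resp-↭ (swap _ _ ↭-refl) (clean-inner-outer (adj (β j) (β k)) (adj (α i) (α k)))
  clean-triangle {i} {j} {k} (no ij) (no jk) (yes ik)
    rewrite hue-outer ij | hue-outer jk | hue-inner ik | ik | adjacent-sym {m} g (α k) (α j) =
    clean-resp-↭ (↭-sym (shift _ (_ ∷ _ ∷ []) []))
      (clean-inner-outer (adj (β i) (β k)) (adj (α j) (α k)))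
  clean-triangle (no ij) (no jk) (no ik)
    rewrite hue-outer ij | hue-outer jk | hue-outer ik =
    clean-without-red (outer≢red _ ∷ outer≢red _ ∷ outer≢red _ ∷ [])

  avoids : Avoids ℋ coloring
  avoids i j k _ _ _ =
    clean-triangle (α i Fin.≟ α j) (α j Fin.≟ α k) (α i Fin.≟ α k)

  module _ (S : Subset n) (z : Color)
           (avoids-z : ∀ i j → i ∈ S → j ∈ S → i ≢ j → hue i j ≢ z) where

    -- Distinct blocks met by `S` are joined by an edge of `S` whose color is `outer` of their
    -- adjacency. The hypothesis on `outer` says that avoiding `z` determines this adjacency;
    -- `fibre-homogeneous` is the same argument for `inner`.
    image-homogeneous : ∀ b → (∀ e → outer e ≢ z → e ≡ b) → Homogeneous {m} g b (image α S)
    image-homogeneous b only a a′ a∈ a′∈ a≢a′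
      with i , i∈ , refl ← ∈-image⁻ α S a∈ | j , j∈ , refl ← ∈-image⁻ α S a′∈ =
      only _ λ eq → avoids-z i j i∈ j∈ (a≢a′ ∘ cong α) (trans (hue-outer a≢a′) eq)

    fibre-homogeneous : ∀ b → (∀ e → inner e ≢ z → e ≡ b) →
                        ∀ a → Homogeneous {m} g b (image β (fibre α S a))
    fibre-homogeneous b only a x x′ x∈ x′∈ x≢x′
      with i , i∈ , refl ← ∈-image⁻ β (fibre α S a) x∈
         | j , j∈ , refl ← ∈-image⁻ β (fibre α S a) x′∈
      with i∈S , αi≡a ← ∈-fibre⁻ α S i∈ | j∈S , αj≡a ← ∈-fibre⁻ α S j∈ =
      only _ λ eq → avoids-z i j i∈S j∈S (x≢x′ ∘ cong β)
        (trans (hue-inner (trans αi≡a (sym αj≡a))) eq)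

  card-fibre : ∀ S a → ∣ fibre α S a ∣ ≤ ∣ image β (fibre α S a) ∣
  card-fibre S a = card-injective β (fibre α S a) λ i∈ j∈ βi≡βj →
    injective (trans (proj₂ (∈-fibre⁻ α S i∈)) (sym (proj₂ (∈-fibre⁻ α S j∈)))) βi≡βj

  card-bound : ∀ {k l} S → ∣ image α S ∣ ≤ k → (∀ a → ∣ image β (fibre α S a) ∣ ≤ l) → ∣ S ∣ ≤ k * l
  card-bound {k} {l} S k-bound l-bound = ≤-trans
    (card-fibres α S λ a → ≤-trans (card-fibre S a) (l-bound a)) (*-monoˡ-≤ l k-bound)

  h₂-bound : ∀ {s t B} → (∀ S → Homogeneous {m} g true S → ∣ S ∣ ≤ s) →
             (∀ S → Homogeneous {m} g false S → ∣ S ∣ ≤ t) →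
             m * s ≤ B → t * t ≤ B → h₂ coloring ≤ B
  h₂-bound {s} {t} {B} cliques independents ms≤B tt≤B
    with S , ∣S∣≡h₂ , x , y , two ← proj₁ (h₂-spec coloring)
    with z , x≢z , y≢z ← missing-color x y = subst (_≤ B) ∣S∣≡h₂ (bound z avoids-z)
    where
    avoids-z : ∀ i j → i ∈ S → j ∈ S → i ≢ j → hue i j ≢ z
    avoids-z i j i∈ j∈ i≢j eq with two i j i∈ j∈ i≢j
    ... | inj₁ ≡x = x≢z (trans (sym ≡x) eq)
    ... | inj₂ ≡y = y≢z (trans (sym ≡y) eq)

    bound : ∀ z → (∀ i j → i ∈ S → j ∈ S → i ≢ j → hue i j ≢ z) → ∣ S ∣ ≤ B
    bound red av = ≤-trans (card-bound S (∣p∣≤n (image α S))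
      (λ a → cliques _ (fibre-homogeneous S red av true
        (λ { true _ → refl ; false ≢red → contradiction refl ≢red }) a))) ms≤B
    bound blue av = ≤-trans (card-bound S
      (cliques _ (image-homogeneous S blue av true
        (λ { true _ → refl ; false ≢blue → contradiction refl ≢blue })))
      (λ a → ∣p∣≤n (image β (fibre α S a)))) (≤-trans (≤-reflexive (*-comm s m)) ms≤B)
    bound yellow av = ≤-trans (card-bound S
      (independents _ (image-homogeneous S yellow av false
        (λ { false _ → refl ; true ≢yellow → contradiction refl ≢yellow })))
      (λ a → independents _ (fibre-homogeneous S yellow av false
        (λ { false _ → refl ; true ≢yellow → contradiction refl ≢yellow }) a))) tt≤B

-- Choosing the size of the Ramsey graph for arbitrary n

order : ℕ → ℕ
order b = (2 ^ suc b) ^ 4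

order-suc : ∀ b → order (suc b) ≡ 16 * order b
order-suc b = expand (2 ^ suc b)
  where
  expand : ∀ q → (2 * q) * ((2 * q) * ((2 * q) * ((2 * q) * 1))) ≡ 16 * (q * (q * (q * (q * 1))))
  expand = solve-∀

[12*q^2]*[12*q^2]≡144*q^4 : ∀ q → (12 * q ^ 2) * (12 * q ^ 2) ≡ 144 * q ^ 4
[12*q^2]*[12*q^2]≡144*q^4 = expand
  where
  expand : ∀ q → (12 * (q * (q * 1))) * (12 * (q * (q * 1))) ≡ 144 * (q * (q * (q * (q * 1))))
  expand = solve-∀

-- The squares of consecutive orders differ by the factor 256, so rounding up to such a square loses
-- at most this factor. The induction keeps `b` until the square becomes too small, then passes to
-- `suc b`.
order-between-squares : ∀ n → ∃[ b ] suc n ≤ order b * order b × order b * order b ≤ 16 * 16 * suc n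
-- `order 0` is 16, so the upper bound is an equality here.
order-between-squares zero    = 0 , m≤m+n 1 255 , ≤-refl
order-between-squares (suc n)
  with b , lower , upper ← order-between-squares n
  with suc (suc n) ≤? order b * order b
... | yes le = b , le , ≤-trans upper (*-monoʳ-≤ (16 * 16) (n≤1+n (suc n)))
... | no ¬le = suc b , low , ≤-trans (≤-reflexive grow) (*-monoʳ-≤ (16 * 16) (<⇒≤ (≰⇒> ¬le)))
  where
  open ≤-Reasoning
  grow : order (suc b) * order (suc b) ≡ 16 * 16 * (order b * order b)
  grow = trans (cong₂ _*_ (order-suc b) (order-suc b))
    ([m*n]*[o*p]≡[m*o]*[n*p] 16 (order b) 16 (order b))
  low : suc (suc n) ≤ order (suc b) * order (suc b)
  low = begin
    1 + suc n                               ≤⟨ +-mono-≤ (≤-trans (s≤s z≤n) lower) lower ⟩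
    order b * order b + order b * order b   ≡⟨ cong (order b * order b +_) (+-identityʳ _) ⟨
    2 * (order b * order b)                 ≤⟨ *-monoˡ-≤ (order b * order b) (m≤m+n 2 254) ⟩
    16 * 16 * (order b * order b)           ≡⟨ grow ⟨
    order (suc b) * order (suc b)           ∎

square-bound : ∀ a c {h N n} → h ≤ a * N → N * N ≤ c * c * n → h * h ≤ (a * c) * (a * c) * n
square-bound a c {h} {N} {n} h≤ N²≤ = begin
  h * h                        ≤⟨ *-mono-≤ h≤ h≤ ⟩
  (a * N) * (a * N)            ≡⟨ [m*n]*[o*p]≡[m*o]*[n*p] a N a N ⟩
  a * a * (N * N)              ≤⟨ *-monoʳ-≤ (a * a) N²≤ ⟩
  a * a * (c * c * n)          ≡⟨ *-assoc (a * a) (c * c) n ⟨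
  a * a * (c * c) * n          ≡⟨ cong (_* n) ([m*n]*[o*p]≡[m*o]*[n*p] a a c c) ⟩
  (a * c) * (a * c) * n        ∎
  where open ≤-Reasoning

-- The vertices are the first `n` cells of an `m` by `m` grid, with quotient and remainder modulo
-- `m` as block and place.
sparse-coloring : ∀ {m n s t B} → RamseyGraph m s t → n ≤ m * m → m * s ≤ B → t * t ≤ B →
                  ∃[ f ] h₂ (proj₁ {B = Avoids {n} ℋ} f) ≤ B
sparse-coloring {m} {n} (g , cliques , independents) n≤m² ms≤B tt≤B =
  (coloring , avoids) , h₂-bound cliques independents ms≤B tt≤B
  where
  position : Fin n → Fin m × Fin m
  position i = remQuot m (inject≤ i n≤m²)

  injective : ∀ {i j} → proj₁ (position i) ≡ proj₁ (position j) →
              proj₂ (position i) ≡ proj₂ (position j) → i ≡ j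
  injective {i} {j} eq₁ eq₂ = Fin.inject≤-injective n≤m² n≤m² i j (begin
    inject≤ i n≤m²                    ≡⟨ Fin.combine-remQuot {m} m (inject≤ i n≤m²) ⟨
    uncurry combine (position i)      ≡⟨ cong₂ combine eq₁ eq₂ ⟩
    uncurry combine (position j)      ≡⟨ Fin.combine-remQuot {m} m (inject≤ j n≤m²) ⟩
    inject≤ j n≤m²                    ∎)
    where open ≡-Reasoning

  open Blowup {m} g (λ i → proj₁ (position i)) (λ i → proj₂ (position i)) injective

minH₂-lower : ∀ n f → n ≤ minH₂ n ℋ f * minH₂ n ℋ f
minH₂-lower n f with f′ , eq ← proj₁ (minH₂-spec n ℋ f) =
  subst (λ h → n ≤ h * h) eq (n≤h₂*h₂ f′)

minH₂-upper : ∀ n f → 1 ≤ n → minH₂ n ℋ f * minH₂ n ℋ f ≤ (144 * 16) * (144 * 16) * n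
minH₂-upper n@(suc n-1) f _ =
  let b , n≤N² , N²≤16²n = order-between-squares n-1
      f′ , h₂≤ = sparse {b} n≤N²
  -- 144 is the ratio of the two-colored bound to `N`, and 16 is the root of the rounding factor
  -- 256.
  in square-bound 144 16 {N = order b} {n}
       (≤-trans (proj₂ (minH₂-spec n ℋ f) _ (f′ , refl)) h₂≤) N²≤16²n
  where
  sparse : ∀ {b} → n ≤ order b * order b → ∃[ f ] h₂ (proj₁ {B = Avoids {n} ℋ} f) ≤ 144 * order b
  sparse {b} n≤N² = sparse-coloring (ramseyGraph b) n≤N²
    -- `144 * order b` equals the square of the independence bound `12 * q ^ 2` and exceeds the
    -- clique bound `10 * order b`.
    (≤-trans (≤-reflexive (*-comm (order b) 10)) (*-monoˡ-≤ (order b) (m≤m+n 10 134)))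
    (≤-reflexive ([12*q^2]*[12*q^2]≡144*q^4 (2 ^ suc b)))

-- From natural to rational inequalities

fromℕᵘ : ℕ → ℚᵘ
fromℕᵘ n = mkℚᵘ (ℤ.+ n) 0

-- `fromℕ` normalizes its fraction and so is awkward for a variable `n`. The unnormalized fraction
-- with denominator one reduces products and comparisons to integers.
toℚᵘ-fromℕ : ∀ n → toℚᵘ (fromℕ n) ℚᵘ.≃ fromℕᵘ n
toℚᵘ-fromℕ n = ℚ.toℚᵘ-fromℚᵘ (fromℕᵘ n)

fromℕ-* : ∀ m n → fromℕ m ℚ.* fromℕ n ≡ fromℕ (m * n)
fromℕ-* m n = ℚ.toℚᵘ-injective (begin
  toℚᵘ (fromℕ m ℚ.* fromℕ n)           ≈⟨ ℚ.toℚᵘ-homo-* (fromℕ m) (fromℕ n) ⟩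
  toℚᵘ (fromℕ m) ℚᵘ.* toℚᵘ (fromℕ n)   ≈⟨ ℚᵘ.*-cong (toℚᵘ-fromℕ m) (toℚᵘ-fromℕ n) ⟩
  fromℕᵘ m ℚᵘ.* fromℕᵘ n               ≈⟨ *≡* (cong (ℤ._* ℤ.1ℤ) (sym (ℤ.pos-* m n))) ⟩
  fromℕᵘ (m * n)                       ≈⟨ toℚᵘ-fromℕ (m * n) ⟨
  toℚᵘ (fromℕ (m * n))                 ∎)
  where open ℚᵘ.≃-Reasoning

fromℕ-mono-≤ : ∀ {m n} → m ≤ n → fromℕ m ℚ.≤ fromℕ n
fromℕ-mono-≤ {m} {n} m≤n = ℚ.toℚᵘ-cancel-≤ (begin
  toℚᵘ (fromℕ m)  ≃⟨ toℚᵘ-fromℕ m ⟩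
  fromℕᵘ m        ≤⟨ *≤* (ℤ.*-monoʳ-≤-nonNeg ℤ.1ℤ (ℤ.+≤+ m≤n)) ⟩
  fromℕᵘ n        ≃⟨ toℚᵘ-fromℕ n ⟨
  toℚᵘ (fromℕ n)  ∎)
  where open ℚᵘ.≤-Reasoning

fromℕ-squares : ∀ c n → fromℕ (c * c * n) ≡ (fromℕ c ℚ.* fromℕ c) ℚ.* fromℕ n
fromℕ-squares c n = trans (sym (fromℕ-* (c * c) n)) (cong (ℚ._* fromℕ n) (sym (fromℕ-* c c)))

lemma2p2 : IsΘ√ (λ n → minH₂ n ℋ (allBlue n))
-- The bound `n ≤ h * h` gives the lower constant 1; `144 * 16` and the threshold 1 are those of
-- `minH₂-upper`.
lemma2p2 = fromℕ 1 , fromℕ (144 * 16) , ℚ.positive⁻¹ (fromℕ 1) , ℚ.positive⁻¹ (fromℕ (144 * 16)) , 1 , λ n 1≤n →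
  let h = minH₂ n ℋ (allBlue n) in
  subst₂ ℚ._≤_ (fromℕ-squares 1 n) (sym (fromℕ-* h h))
    (fromℕ-mono-≤ (≤-trans (≤-reflexive (*-identityˡ n)) (minH₂-lower n (allBlue n)))) ,
  subst₂ ℚ._≤_ (sym (fromℕ-* h h)) (fromℕ-squares (144 * 16) n)
    (fromℕ-mono-≤ (minH₂-upper n (allBlue n) 1≤n))
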